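{- Let $\lambda=[\lambda_1,\ldots,\lambda_r]$ be a nonempty partition distinct from $[1]$. Then $\lambda$ is a losing position ($\mathcal P$-position) of the game Rook under normal play if and only if $\lambda$ has rank $0$ and $\lambda[1,1]\ge \mathrm{Stair}^{r-1}$.
   Context: A partition is a finite weakly decreasing sequence $\lambda=[\lambda_1,\ldots,\lambda_r]$ of positive integers ($r\ge 0$; $[\,]$ is the empty partition). For $i,j\ge 0$ the subpartition $\lambda[i,j]$ is $[\lambda_{i+1}-j,\lambda_{i+2}-j,\ldots]$ with trailing nonpositive entries removed (delete the first $i$ rows and first $j$ columns of the Young diagram). Order (Young lattice): $[\lambda_1,\ldots,\lambda_r]\le[\beta_1,\ldots,\beta_m]$ iff $r\le m$ and $\lambda_i\le\beta_i$ for all $i\le r$. The rank of $\lambda=[\lambda_1,\dots,\lambda_r]$ is $|\lambda_1-r|$. The staircase is $\mathrm{Stair}^{k}=[k,k-1,\ldots,1]$ for $k \geq 1$ ($\mathrm{Stair}^0=[\,]$). Rook is the two-player impartial game whose positions are nonempty partitions; from $\lambda$ a player may move to $\lambda[i,j]$ for any $(i,j)\in\{(k,0):k\ge1\}\cup\{(0,k):k\ge1\}$ such that $\lambda[i,j]\neq[\,]$. Normal play: the player who cannot move loses. A position is losing ($\mathcal P$) if no move from it leads to a $\mathcal P$-position (in particular terminal positions are $\mathcal P$); otherwise it is winning ($\mathcal N$). -}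

module Defs where

open import Data.Fin using (Fin; inject≤)
open import Data.List using (List; []; _∷_; applyDownFrom; drop; filter; length; lookup; map)
open import Data.List.Relation.Unary.All using (All; []; _∷_)
import Data.List.Relation.Unary.All.Properties as All
open import Data.List.Relation.Unary.Linked using (Linked; []; [-]; _∷_)
import Data.List.Relation.Unary.Linked as Linked
import Data.List.Relation.Unary.Linked.Properties as Linked
open import Data.Nat
open import Data.Nat.Induction using (<-wellFounded)
open import Data.Nat.ListAction using (sum)
open import Data.Nat.Properties
open import Data.Product using (Σ-syntax)
open import Function using (_∘_; _⇔_; flip; mk⇔)
open import Induction.WellFounded using (Acc; acc; WellFounded; module Subrelation)
import Relation.Binary.Construct.On as On
open import Relation.Binary.PropositionalEquality using (_≡_; _≢_; refl)
open import Relation.Nullary using (¬_; contradiction)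

record Partition : Set where
  constructor mkPartition
  field
    parts      : List ℕ
    decreasing : Linked _≥_ parts
    positive   : All (0 <_) parts

open Partition public

-- `_∸_` truncates at 0, so the nonpositive entries λₖ - j are exactly the zeros;
-- as the parts decrease weakly these are all trailing, so filtering them out
-- removes the trailing nonpositive entries.
subparts : ℕ → ℕ → List ℕ → List ℕ
subparts i j xs = filter (0 <?_) (map (_∸ j) (drop i xs))

private
  drop-linked : ∀ i {xs} → Linked _≥_ xs → Linked _≥_ (drop i xs)
  drop-linked zero    l       = l
  drop-linked (suc i) []      = []
  drop-linked (suc i) [-]     = drop-linked i []
  drop-linked (suc i) (_ ∷ l) = drop-linked i l

sub : Partition → ℕ → ℕ → Partition
sub p i j = mkPartition (subparts i j (parts p))
  (Linked.filter⁺ (0 <?_) (flip ≤-trans)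
    (Linked.map⁺ (Linked.map (∸-monoˡ-≤ j) (drop-linked i (decreasing p)))))
  (All.all-filter (0 <?_) (map (_∸ j) (drop i (parts p))))

infix 4 _≤Y_
_≤Y_ : Partition → Partition → Set
p ≤Y q = Σ[ r≤m ∈ length (parts p) ≤ length (parts q) ]
  (∀ (k : Fin (length (parts p))) → lookup (parts p) k ≤ lookup (parts q) (inject≤ k r≤m))

Stair : ℕ → Partition
Stair k = mkPartition (applyDownFrom suc k)
  (Linked.applyDownFrom⁺₂ suc k (λ i → n≤1+n (suc i)))
  (All.applyDownFrom⁺₂ suc k (λ _ → z<s))

record Position : Set where
  constructor mkPosition
  field
    partition : Partition
    nonempty  : parts partition ≢ []

open Position public

rankOf : (xs : List ℕ) → xs ≢ [] → ℕ
rankOf []       ne = contradiction refl ne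
rankOf (x ∷ xs) _  = ∣ x - length (x ∷ xs) ∣

rank : Position → ℕ
rank π = rankOf (parts (partition π)) (nonempty π)

infix 4 _⟶_
data _⟶_ (π : Position) : Position → Set where
  rows : ∀ k → k ≥ 1 → (ne : parts (sub (partition π) k 0) ≢ []) →
         π ⟶ mkPosition (sub (partition π) k 0) ne
  cols : ∀ k → k ≥ 1 → (ne : parts (sub (partition π) 0 k) ≢ []) →
         π ⟶ mkPosition (sub (partition π) 0 k) ne

private
  size : Position → ℕ
  size π = sum (parts (partition π))

  sum-filter : ∀ xs → sum (filter (0 <?_) xs) ≡ sum xs
  sum-filter []           = refl
  sum-filter (zero  ∷ xs) = sum-filter xs
  sum-filter (suc x ∷ xs) rewrite sum-filter xs = refl

  sum-∸ : ∀ j xs → sum (map (_∸ j) xs) ≤ sum xs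
  sum-∸ j []       = z≤n
  sum-∸ j (x ∷ xs) = +-mono-≤ (m∸n≤m x j) (sum-∸ j xs)

  sum-drop : ∀ i xs → sum (drop i xs) ≤ sum xs
  sum-drop zero    xs       = ≤-refl
  sum-drop (suc i) []       = z≤n
  sum-drop (suc i) (x ∷ xs) = ≤-trans (sum-drop i xs) (m≤n+m (sum xs) x)

  rows-< : ∀ k xs → k ≥ 1 → xs ≢ [] → All (0 <_) xs → sum (subparts k 0 xs) < sum xs
  rows-< k       []       _ ne _ = contradiction refl ne
  rows-< (suc k) (x ∷ xs) _ _  (0<x ∷ _)
    rewrite sum-filter (map (_∸ 0) (drop k xs)) =
      +-mono-≤ 0<x (≤-trans (sum-∸ 0 (drop k xs)) (sum-drop k xs))

  cols-< : ∀ k xs → k ≥ 1 → xs ≢ [] → All (0 <_) xs → sum (subparts 0 k xs) < sum xs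
  cols-< k       []           _ ne _ = contradiction refl ne
  cols-< (suc k) (zero ∷ xs)  _ _  (() ∷ _)
  cols-< (suc k) (suc x ∷ xs) _ _  _
    rewrite sum-filter (map (_∸ suc k) (suc x ∷ xs)) =
      s≤s (+-mono-≤ (m∸n≤m x k) (sum-∸ (suc k) xs))

  ⟶⇒< : ∀ {π ρ} → π ⟶ ρ → size ρ < size π
  ⟶⇒< {π} (rows k k≥1 _) =
    rows-< k (parts (partition π)) k≥1 (nonempty π) (positive (partition π))
  ⟶⇒< {π} (cols k k≥1 _) =
    cols-< k (parts (partition π)) k≥1 (nonempty π) (positive (partition π))

⟶-wellFounded : WellFounded (flip _⟶_)
⟶-wellFounded = Subrelation.wellFounded ⟶⇒< (On.wellFounded size <-wellFounded)

-- The clause "π is losing iff no move from it leads to a losing position" refers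
-- to itself negatively, so it is read as a recursion along moves; `Losing-unfold`
-- recovers the clause itself.
LosingAcc : ∀ {π} → Acc (flip _⟶_) π → Set
LosingAcc {π} (acc rs) = ∀ {ρ} (m : π ⟶ ρ) → ¬ LosingAcc (rs m)

Losing : Position → Set
Losing π = LosingAcc (⟶-wellFounded π)

private
  LosingAcc-irrelevant : ∀ {π} (a b : Acc (flip _⟶_) π) → LosingAcc a → LosingAcc b
  LosingAcc-irrelevant (acc rs) (acc ss) l m l′ =
    l m (LosingAcc-irrelevant (ss m) (rs m) l′)

  LosingAcc-unfold : ∀ {π} (a : Acc (flip _⟶_) π) →
                     LosingAcc a ⇔ (∀ {ρ} → π ⟶ ρ → ¬ Losing ρ)
  LosingAcc-unfold (acc rs) = mk⇔
    (λ l {ρ} m → l m ∘ LosingAcc-irrelevant (⟶-wellFounded ρ) (rs m))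
    (λ l {ρ} m → l m ∘ LosingAcc-irrelevant (rs m) (⟶-wellFounded ρ))

Losing-unfold : ∀ π → Losing π ⇔ (∀ {ρ} → π ⟶ ρ → ¬ Losing ρ)
Losing-unfold π = LosingAcc-unfold (⟶-wellFounded π)

{-# OPTIONS --safe #-}
-- View a partition as its antitone function p of parts (0-based, eventually 0),
-- so that (i , j) is a cell iff j < p i. Put r for the number of rows and c = p 0.
-- The losing positions are those with c = r that contain every cell (i , c - i),
-- 0 < i < c; [1] satisfies this vacuously. A row deletion of such a partition leaves
-- a first row longer than the first column, and a column deletion the opposite.
-- Conversely, if c ≤ r, take the largest i < r with (i , r - i) not a cell:
-- deleting i rows gives a partition of this kind. If r ≤ c, do the same with
-- columns and the cells (c - m , m).
module Submission where

open import Defs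
open import Data.Fin using (Fin; toℕ; fromℕ<; inject≤)
open import Data.Fin.Properties using (toℕ-fromℕ<; toℕ-inject≤)
open import Data.List using (List; []; _∷_; applyDownFrom; drop; filter; length; lookup; map)
open import Data.List.Relation.Unary.All using (All; []; _∷_)
open import Data.List.Relation.Unary.Linked using (Linked; []; [-]; _∷_)
open import Data.Nat
open import Data.Nat.Properties
open import Data.Product using (∃-syntax; _×_; _,_; proj₁)
open import Data.Sum using (_⊎_; inj₁; inj₂)
open import Function using (_⇔_; _∘_; flip; mk⇔; Equivalence)
open import Function.Construct.Composition using (_⇔-∘_)
open import Induction.WellFounded using (Acc; acc)
open import Relation.Binary.PropositionalEquality
  using (_≡_; _≢_; refl; sym; trans; cong; subst; subst₂)
open import Relation.Nullary using (¬_; yes; no; contradiction)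
open import Relation.Unary using (Decidable)

open Equivalence using (to; from)

-- Antitone functions and a bounded search.

Antitone : (ℕ → ℕ) → Set
Antitone p = ∀ k → p (suc k) ≤ p k

antitone-≤ : ∀ {p} → Antitone p → ∀ {i j} → i ≤ j → p j ≤ p i
antitone-≤ {p} anti i≤j = go (≤⇒≤′ i≤j)
  where
  go : ∀ {i j} → i ≤′ j → p j ≤ p i
  go (≤′-reflexive refl) = ≤-refl
  go (≤′-step i≤′j)      = ≤-trans (anti _) (go i≤′j)

largest-below : ∀ {P : ℕ → Set} → Decidable P → P 0 → ∀ n →
                ∃[ i ] i < suc n × P i × (∀ {j} → i < j → j < suc n → ¬ P j)
largest-below P? P0 zero = 0 , z<s , P0 , λ 0<j j<1 _ → <⇒≱ 0<j (≤-pred j<1)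
largest-below {P} P? P0 (suc n) with P? (suc n)
... | yes Pn = suc n , ≤-refl , Pn , λ n<j j<n _ → <⇒≱ n<j (≤-pred j<n)
... | no ¬Pn with largest-below P? P0 n
...   | i , i<n , Pi , above = i , m<n⇒m<1+n i<n , Pi , above′
  where
  above′ : ∀ {j} → i < j → j < suc (suc n) → ¬ P j
  above′ {j} i<j j<2+n with m≤n⇒m<n∨m≡n (≤-pred j<2+n)
  ... | inj₁ j<1+n = above i<j j<1+n
  ... | inj₂ refl  = ¬Pn

-- The kernel property and deletion of rows or columns.

-- The first component gives only `r ≤ c`; the second supplies `c ≤ r`, through `kernel-last-row`.
-- The inequality `p 0 < i + p i` says, without truncated subtraction, that `(i , p 0 - i)` is a
-- cell.
Kernel : (ℕ → ℕ) → Set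
Kernel p = p (p 0) ≡ 0 × (∀ {i} → 0 < i → i < p 0 → p 0 < i + p i)

Kernel-resp : ∀ {p q} → (∀ k → p k ≡ q k) → Kernel p → Kernel q
Kernel-resp {p} {q} p≗q (end , diag) rewrite sym (p≗q 0) =
  trans (sym (p≗q (p 0))) end ,
  λ {i} 0<i i<c → subst (λ x → p 0 < i + x) (p≗q i) (diag 0<i i<c)

-- For `n > 0` the diagonal cell of row `n` is `(n , 1)`. Row 0 carries no diagonal condition, but
-- there `p 0 = 1`.
kernel-last-row : ∀ {p n} → Kernel p → p 0 ≡ suc n → 0 < p n
kernel-last-row {p} {zero}  _          c≡ = subst (0 <_) (sym c≡) z<s
kernel-last-row {p} {suc n} (_ , diag) c≡ = +-cancelˡ-< (suc n) 0 (p (suc n))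
  (subst (_< suc n + p (suc n)) (sym (+-identityʳ (suc n)))
    (<-trans (n<1+n (suc n))
      (subst (_< suc n + p (suc n)) c≡ (diag z<s (subst (suc n <_) (sym c≡) ≤-refl)))))

-- The remaining partition has first row `p k`; if it had the property, it would have `p k` rows
-- too, forcing `k + p k ≤ p 0`. The diagonal cell in row `k` says the opposite.
kernel-rows : ∀ {p} → Antitone p → Kernel p → ∀ {k} → 0 < k → 0 < p k →
              ¬ Kernel (λ i → p (k + i))
kernel-rows {p} anti (end , diag) {k} 0<k 0<pk K′ = <⇒≱ (diag 0<k (inside 0<pk)) k+pk≤c
  where
  inside : ∀ {i} → 0 < p i → i < p 0
  inside 0<pi = ≰⇒> λ c≤i → <⇒≱ 0<pi (≤-trans (antitone-≤ anti c≤i) (≤-reflexive end))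

  pk≡suc : p k ≡ suc (pred (p k))
  pk≡suc = sym (suc-pred (p k) {{>-nonZero 0<pk}})

  k+pk≤c : k + p k ≤ p 0
  k+pk≤c = subst (_≤ p 0) (trans (sym (+-suc k (pred (p k)))) (cong (k +_) (sym pk≡suc)))
    (inside (kernel-last-row {λ i → p (k + i)} K′ (trans (cong p (+-identityʳ k)) pk≡suc)))

-- The remaining partition has `p 0 ∸ k` columns, so the property would leave row `p 0 ∸ k` empty
-- after the deletion. But `(p 0 ∸ k , k)` is a diagonal cell of `p` and survives.
kernel-cols : ∀ {p} → Kernel p → ∀ {k} → 0 < k → k < p 0 → ¬ Kernel (λ i → p i ∸ k)
kernel-cols {p} (_ , diag) {k} 0<k k<c (end , _) = <⇒≱
  (diag (m<n⇒0<n∸m k<c) (∸-monoʳ-< 0<k (<⇒≤ k<c)))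
  (≤-trans (+-monoʳ-≤ (p 0 ∸ k) (m∸n≡0⇒m≤n end)) (≤-reflexive (m∸n+n≡m (<⇒≤ k<c))))

-- As `p` is antitone, `i + p i` rises by at most one per row. So at the largest `k ≤ r` where it is
-- at most `suc r` it equals `suc r`, and the remaining rows and columns are equal in number.
-- Maximality of `k` provides the diagonal cells.
rows-to-kernel : ∀ {p} → Antitone p → ∀ {r} → 0 < p r → p (suc r) ≡ 0 → p 0 ≤ suc r →
                 ∃[ k ] 0 < p k × Kernel (λ i → p (k + i))
rows-to-kernel {p} anti {r} 0<pr end c≤r
  with largest-below (λ i → i + p i ≤? suc r) c≤r r
... | k , k<r , k+pk≤r , above =
  k , <-≤-trans 0<pr (antitone-≤ anti (≤-pred k<r)) ,
  subst (λ c → p (k + c) ≡ 0 × (∀ {i} → 0 < i → i < c → c < i + p (k + i)))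
    (cong p (sym (+-identityʳ k)))
    (trans (cong p k+pk≡r) end , diag)
  where
  r≤k+pk : suc r ≤ k + p k
  r≤k+pk with m≤n⇒m<n∨m≡n (≤-pred k<r)
  ... | inj₁ k<r  = ≤-pred (≤-trans (≰⇒> (above ≤-refl (s≤s k<r))) (s≤s (+-monoʳ-≤ k (anti k))))
  -- No later row bounds `k + p k` from below here; nonemptiness of the last row does.
  ... | inj₂ refl = subst (_≤ r + p r) (+-comm r 1) (+-monoʳ-≤ r 0<pr)

  k+pk≡r : k + p k ≡ suc r
  k+pk≡r = ≤-antisym k+pk≤r r≤k+pk

  diag : ∀ {i} → 0 < i → i < p k → p k < i + p (k + i)
  diag {i} 0<i i<pk = +-cancelˡ-< k (p k) (i + p (k + i))
    (subst₂ _<_ (sym k+pk≡r) (+-assoc k i (p (k + i)))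
      (≰⇒> (above (m<m+n k 0<i) (subst (k + i <_) k+pk≡r (+-monoʳ-< k i<pk)))))

-- Here the bound on the number of rows is immediate: `(p 0 ∸ k , k)` not being a cell means that
-- row `p 0 ∸ k` vanishes when `k` columns are deleted. Maximality of `k` again gives the diagonal.
cols-to-kernel : ∀ {p c} → p 0 ≡ suc c → p (suc c) ≡ 0 →
                 ∃[ k ] k < p 0 × Kernel (λ i → p i ∸ k)
cols-to-kernel {p} {c} c≡ end
  with largest-below (λ m → p (p 0 ∸ m) ≤? m) (≤-reflexive (trans (cong p c≡) end)) c
... | k , k<c′ , out , above′ = k , k<c , m≤n⇒m∸n≡0 out , diag
  where
  k<c : k < p 0
  k<c = subst (k <_) (sym c≡) k<c′

  above : ∀ {j} → k < j → j < p 0 → ¬ p (p 0 ∸ j) ≤ j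
  above k<j j<c = above′ k<j (subst (_ <_) c≡ j<c)

  diag : ∀ {i} → 0 < i → i < p 0 ∸ k → p 0 ∸ k < i + (p i ∸ k)
  diag {i} 0<i i<c∸k = +-cancelʳ-< k (p 0 ∸ k) (i + (p i ∸ k))
    (subst₂ _<_ (sym (m∸n+n≡m (<⇒≤ k<c))) lhs≡ c<i+pi)
    where
    i+k<c : i + k < p 0
    i+k<c = subst (i + k <_) (m∸n+n≡m (<⇒≤ k<c)) (+-monoˡ-< k i<c∸k)

    i≤c : i ≤ p 0
    i≤c = ≤-trans (m≤m+n i k) (<⇒≤ i+k<c)

    k<c∸i : k < p 0 ∸ i
    k<c∸i = m+n≤o⇒m≤o∸n (suc k) (subst (_≤ p 0) (cong suc (+-comm i k)) i+k<c)

    -- Maximality of `k` is applied to `m = p 0 ∸ i`, for which the cell `(p 0 ∸ m , m)` lies in row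
    -- `i`.
    c∸i<pi : p 0 ∸ i < p i
    c∸i<pi = subst (λ x → p 0 ∸ i < p x) (m∸[m∸n]≡n i≤c)
      (≰⇒> (above k<c∸i (∸-monoʳ-< 0<i i≤c)))

    c<i+pi : p 0 < i + p i
    c<i+pi = subst (_< i + p i) (m+[n∸m]≡n i≤c) (+-monoʳ-< i c∸i<pi)

    -- Since `k < p i`, the subtraction `p i ∸ k` is not truncated.
    lhs≡ : i + p i ≡ i + (p i ∸ k) + k
    lhs≡ = trans (cong (i +_) (sym (m∸n+n≡m (<⇒≤ (<-trans k<c∸i c∸i<pi)))))
      (sym (+-assoc i (p i ∸ k) k))

-- Partitions as functions of the row index.

part : List ℕ → ℕ → ℕ
part []       _       = 0
part (x ∷ xs) zero    = x
part (x ∷ xs) (suc k) = part xs k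

part-antitone : ∀ {xs} → Linked _≥_ xs → Antitone (part xs)
part-antitone []        _       = z≤n
part-antitone [-]       _       = z≤n
part-antitone (x≥y ∷ _) zero    = x≥y
part-antitone (_ ∷ l)   (suc k) = part-antitone l k

part-drop : ∀ i xs k → part (drop i xs) k ≡ part xs (i + k)
part-drop zero    xs       k = refl
part-drop (suc i) []       k = refl
part-drop (suc i) (x ∷ xs) k = part-drop i xs k

part-map-∸ : ∀ j xs k → part (map (_∸ j) xs) k ≡ part xs k ∸ j
part-map-∸ j []       k       = sym (0∸n≡0 j)
part-map-∸ j (x ∷ xs) zero    = refl
part-map-∸ j (x ∷ xs) (suc k) = part-map-∸ j xs k

-- Antitonicity puts all zeros at the end, so removing them shifts no positive entry, and the
-- default value 0 replaces them.
part-filter : ∀ xs → Antitone (part xs) → ∀ k → part (filter (0 <?_) xs) k ≡ part xs k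
part-filter []           anti k       = refl
part-filter (suc x ∷ xs) anti zero    = refl
part-filter (suc x ∷ xs) anti (suc k) = part-filter xs (anti ∘ suc) k
part-filter (zero ∷ xs)  anti k       = trans (part-filter xs (anti ∘ suc) k)
  (trans (n≤0⇒n≡0 (antitone-≤ anti {0} {suc k} z≤n))
    (sym (n≤0⇒n≡0 (antitone-≤ anti {0} {k} z≤n))))

profile : Partition → ℕ → ℕ
profile p = part (parts p)

profile-antitone : ∀ p → Antitone (profile p)
profile-antitone p = part-antitone (decreasing p)

profile-sub : ∀ p i j k → profile (sub p i j) k ≡ profile p (i + k) ∸ j
profile-sub p i j k = trans (part-filter ys anti k) (part-ys k)
  where
  ys : List ℕ
  ys = map (_∸ j) (drop i (parts p))

  part-ys : ∀ k → part ys k ≡ profile p (i + k) ∸ j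
  part-ys k = trans (part-map-∸ j (drop i (parts p)) k) (cong (_∸ j) (part-drop i (parts p) k))

  anti : Antitone (part ys)
  anti k = subst₂ _≤_ (sym (part-ys (suc k))) (sym (part-ys k))
    (∸-monoˡ-≤ j (antitone-≤ (profile-antitone p) (+-monoʳ-≤ i (n≤1+n k))))

part-beyond : ∀ xs {k} → length xs ≤ k → part xs k ≡ 0
part-beyond []       _         = refl
part-beyond (x ∷ xs) (s≤s r≤k) = part-beyond xs r≤k

part-within : ∀ {xs} → All (0 <_) xs → ∀ {k} → k < length xs → 0 < part xs k
part-within (0<x ∷ _) {zero}  _         = 0<x
part-within (_ ∷ pos) {suc k} (s≤s k<r) = part-within pos k<r

part-pos⇒< : ∀ xs {k} → 0 < part xs k → k < length xs
part-pos⇒< xs 0<xk = ≰⇒> λ r≤k → <⇒≢ 0<xk (sym (part-beyond xs r≤k))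

part-zero⇒≤ : ∀ {xs} → All (0 <_) xs → ∀ {k} → part xs k ≡ 0 → length xs ≤ k
part-zero⇒≤ pos xk≡0 = ≮⇒≥ λ k<r → <⇒≢ (part-within pos k<r) (sym xk≡0)

part-lookup : ∀ xs (k : Fin (length xs)) → lookup xs k ≡ part xs (toℕ k)
part-lookup (x ∷ xs) Fin.zero    = refl
part-lookup (x ∷ xs) (Fin.suc k) = part-lookup xs k

part-stair : ∀ n k → part (applyDownFrom suc n) k ≡ n ∸ k
part-stair zero    k       = sym (0∸n≡0 k)
part-stair (suc n) zero    = refl
part-stair (suc n) (suc k) = part-stair n k

≤Y⇔profile : ∀ p q → p ≤Y q ⇔ (∀ k → profile p k ≤ profile q k)
≤Y⇔profile p q = mk⇔ fwd bwd
  where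
  lookup-inject≤ : ∀ (r≤m : length (parts p) ≤ length (parts q)) k →
                   lookup (parts q) (inject≤ k r≤m) ≡ profile q (toℕ k)
  lookup-inject≤ r≤m k = trans (part-lookup (parts q) (inject≤ k r≤m))
    (cong (profile q) (toℕ-inject≤ k r≤m))

  fwd : p ≤Y q → ∀ k → profile p k ≤ profile q k
  fwd (r≤m , le) k with k <? length (parts p)
  ... | no k≮r = subst (_≤ profile q k) (sym (part-beyond (parts p) (≮⇒≥ k≮r))) z≤n
  ... | yes k<r = subst (λ i → profile p i ≤ profile q i) (toℕ-fromℕ< k<r)
    (subst₂ _≤_ (part-lookup (parts p) (fromℕ< k<r)) (lookup-inject≤ r≤m (fromℕ< k<r))
      (le (fromℕ< k<r)))

  bwd : (∀ k → profile p k ≤ profile q k) → p ≤Y q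
  bwd le = r≤m , λ k → subst₂ _≤_ (sym (part-lookup (parts p) k)) (sym (lookup-inject≤ r≤m k))
    (le (toℕ k))
    where
    r≤m : length (parts p) ≤ length (parts q)
    -- Otherwise row `length (parts q)` would be positive in `p` and 0 in `q`.
    r≤m = ≮⇒≥ λ m<r → <⇒≱ (part-within (positive p) m<r)
      (≤-trans (le (length (parts q))) (≤-reflexive (part-beyond (parts q) ≤-refl)))

-- The losing positions as the kernel of the move graph.

profile-0-pos : ∀ p → parts p ≢ [] → 0 < profile p 0
profile-0-pos (mkPartition []      _ _)         ne = contradiction refl ne
profile-0-pos (mkPartition (_ ∷ _) _ (0<x ∷ _)) _  = 0<x

pos⇒nonempty : ∀ p → 0 < profile p 0 → parts p ≢ []
pos⇒nonempty p 0<c refl = contradiction 0<c λ ()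

InKernel : Position → Set
InKernel π = Kernel (profile (partition π))

profile-rows : ∀ p k i → profile (sub p k 0) i ≡ profile p (k + i)
profile-rows p k i = profile-sub p k 0 i

-- Independence, one half of being a kernel in the sense of graph theory; `InKernel-reachable` is
-- the other half, absorption.
InKernel-stable : ∀ {π ρ} → InKernel π → π ⟶ ρ → ¬ InKernel ρ
InKernel-stable {π} K (rows k k≥1 ne) K′ =
  kernel-rows (profile-antitone p) K k≥1
    (subst (0 <_) (trans (profile-rows p k 0) (cong (profile p) (+-identityʳ k)))
      (profile-0-pos (sub p k 0) ne))
    (Kernel-resp (profile-rows p k) K′)
  where p = partition π
InKernel-stable {π} K (cols k k≥1 ne) K′ =
  kernel-cols {profile p} K k≥1
    (m∸n≢0⇒n<m (n>0⇒n≢0 (subst (0 <_) (profile-sub p 0 k 0) (profile-0-pos (sub p 0 k) ne))))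
    (Kernel-resp (profile-sub p 0 k) K′)
  where p = partition π

-- Comparing the first row with the number of rows decides which search applies. The outcome `k = 0`
-- deletes nothing, so `π` itself is in the kernel; any other `k` is a legal move.
InKernel-reachable : ∀ π → InKernel π ⊎ (∃[ ρ ] (π ⟶ ρ × InKernel ρ))
InKernel-reachable (mkPosition (mkPartition [] _ _) ne) = contradiction refl ne
InKernel-reachable (mkPosition (mkPartition (zero ∷ _) _ (() ∷ _)) _)
InKernel-reachable π@(mkPosition p@(mkPartition (suc x ∷ xs) _ _) ne)
  with ≤-total (suc x) (length (suc x ∷ xs))
... | inj₁ c≤r = byRows (rows-to-kernel (profile-antitone p)
        (part-within (positive p) ≤-refl) (part-beyond (suc x ∷ xs) ≤-refl) c≤r)
  where
  byRows : (∃[ k ] 0 < profile p k × Kernel (λ i → profile p (k + i))) →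
           InKernel π ⊎ (∃[ ρ ] (π ⟶ ρ × InKernel ρ))
  byRows (zero  , _ , K)    = inj₁ K
  byRows (suc k , 0<pk , K) = inj₂ (_ , rows (suc k) z<s
      (pos⇒nonempty (sub p (suc k) 0)
        (subst (0 <_) (sym (trans (profile-rows p (suc k) 0)
          (cong (profile p) (+-identityʳ (suc k))))) 0<pk)) ,
    Kernel-resp (sym ∘ profile-rows p (suc k)) K)
... | inj₂ r≤c = byCols (cols-to-kernel {profile p} refl
        (part-beyond (suc x ∷ xs) r≤c))
  where
  byCols : (∃[ k ] k < profile p 0 × Kernel (λ i → profile p i ∸ k)) →
           InKernel π ⊎ (∃[ ρ ] (π ⟶ ρ × InKernel ρ))
  byCols (zero  , _ , K)    = inj₁ K
  byCols (suc k , k<c , K) = inj₂ (_ , cols (suc k) z<s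
      (pos⇒nonempty (sub p 0 (suc k))
        (subst (0 <_) (sym (profile-sub p 0 (suc k) 0)) (m<n⇒0<n∸m k<c))) ,
    Kernel-resp (sym ∘ profile-sub p 0 (suc k)) K)

-- Induction along moves: in a well-founded game an independent and absorbing set can only be the
-- set of losing positions.
LosingAcc⇔InKernel : ∀ {π} (a : Acc (flip _⟶_) π) → LosingAcc a ⇔ InKernel π
LosingAcc⇔InKernel {π} (acc rs) = mk⇔ fwd
  (λ K m l → InKernel-stable K m (to (LosingAcc⇔InKernel (rs m)) l))
  where
  fwd : LosingAcc (acc rs) → InKernel π
  fwd l with InKernel-reachable π
  ... | inj₁ K           = K
  ... | inj₂ (_ , m , K) = contradiction (from (LosingAcc⇔InKernel (rs m)) K) (l m)

-- The kernel in terms of rank and staircase.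

kernel⇒c≡length : ∀ {xs} → All (0 <_) xs → xs ≢ [] → Kernel (part xs) → part xs 0 ≡ length xs
kernel⇒c≡length {[]}         _   ne _ = contradiction refl ne
kernel⇒c≡length {zero ∷ xs}  (() ∷ _)
kernel⇒c≡length {suc x ∷ xs} pos _  K = ≤-antisym
  (part-pos⇒< (suc x ∷ xs) (kernel-last-row {part (suc x ∷ xs)} K refl))
  (part-zero⇒≤ pos (proj₁ K))

-- The comparison of `Stair (r ∸ 1)` with the partition without its first row and column, read row
-- by row, with `p 0` in place of `r`; rank 0 identifies the two.
Staircase : (ℕ → ℕ) → Set
Staircase p = ∀ k → p 0 ∸ 1 ∸ k ≤ p (suc k) ∸ 1

-- With `i = suc k`, the inequality `p 0 < i + p i` is `p 0 - i ≤ p i - 1`; only the truncations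
-- need care.
kernel⇒staircase : ∀ {p} → Kernel p → Staircase p
kernel⇒staircase {p} (_ , diag) k with suc k <? p 0
-- From row `p 0` on, the staircase entry is truncated to 0.
... | no k≮ = ≤-trans (≤-reflexive (trans (∸-+-assoc (p 0) 1 k) (m≤n⇒m∸n≡0 (≮⇒≥ k≮)))) z≤n
... | yes k< = ≤-trans (≤-reflexive (∸-+-assoc (p 0) 1 k)) (≤-pred (≤-trans
      (m<n+o⇒m∸n<o _ _ {{>-nonZero 0<pk}} (diag z<s k<))
      (m≤n+m∸n _ 1)))
  where
  0<pk : 0 < p (suc k)
  0<pk = n≢0⇒n>0 λ pk≡0 → <-asym k<
    (subst (p 0 <_) (trans (cong (suc k +_) pk≡0) (+-identityʳ (suc k))) (diag z<s k<))

staircase⇒diag : ∀ {p} → Staircase p → ∀ {i} → 0 < i → i < p 0 → p 0 < i + p i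
staircase⇒diag {p} st {suc k} _ k<c with p (suc k) | st k
-- Truncation makes the right side 0 for an empty row, but `suc k < p 0` makes the staircase entry
-- positive.
... | zero  | le = contradiction
        (≤-trans (≤-reflexive (sym (∸-+-assoc (p 0) 1 k))) le) (<⇒≱ (m<n⇒0<n∸m k<c))
... | suc y | le = ≤-trans
        (s≤s (≤-trans (m≤n+m∸n (p 0) (suc k))
          (+-monoʳ-≤ (suc k) (≤-trans (≤-reflexive (sym (∸-+-assoc (p 0) 1 k))) le))))
        (≤-reflexive (sym (+-suc (suc k) y)))

InKernel⇔ : ∀ π → InKernel π ⇔
  (rank π ≡ 0 × Stair (length (parts (partition π)) ∸ 1) ≤Y sub (partition π) 1 1)
InKernel⇔ (mkPosition (mkPartition [] _ _) ne) = contradiction refl ne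
InKernel⇔ (mkPosition p@(mkPartition xs@(x ∷ _) _ pos) ne) = mk⇔ fwd bwd
  where
  r : ℕ
  r = length xs

  stair≤sub : Stair (r ∸ 1) ≤Y sub p 1 1 ⇔
              (∀ k → profile (Stair (r ∸ 1)) k ≤ profile (sub p 1 1) k)
  stair≤sub = ≤Y⇔profile (Stair (r ∸ 1)) (sub p 1 1)

  fwd : Kernel (part xs) → ∣ x - r ∣ ≡ 0 × Stair (r ∸ 1) ≤Y sub p 1 1
  fwd K = m≡n⇒∣m-n∣≡0 x≡r , from stair≤sub λ k →
    subst₂ _≤_ (trans (cong (λ c → c ∸ 1 ∸ k) x≡r) (sym (part-stair (r ∸ 1) k)))
      (sym (profile-sub p 1 1 k)) (kernel⇒staircase {part xs} K k)
    where
    x≡r : x ≡ r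
    x≡r = kernel⇒c≡length pos ne K

  bwd : ∣ x - r ∣ ≡ 0 × Stair (r ∸ 1) ≤Y sub p 1 1 → Kernel (part xs)
  bwd (rank≡0 , st) = part-beyond xs (≤-reflexive (sym x≡r)) ,
    staircase⇒diag {part xs} λ k → subst₂ _≤_
      (trans (part-stair (r ∸ 1) k) (cong (λ c → c ∸ 1 ∸ k) (sym x≡r)))
      (profile-sub p 1 1 k) (to stair≤sub st k)
    where
    x≡r : x ≡ r
    x≡r = ∣m-n∣≡0⇒m≡n rank≡0

theorem3p16 : (π : Position) → parts (partition π) ≢ 1 ∷ [] →
    Losing π ⇔ (rank π ≡ 0 × Stair (length (parts (partition π)) ∸ 1) ≤Y sub (partition π) 1 1)
theorem3p16 π _ = InKernel⇔ π ⇔-∘ LosingAcc⇔InKernel (⟶-wellFounded π)
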